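{- Let $n\in\mathbb{N}$ and let $\mathcal{U}(n)$ be the $n$-universal model of intuitionistic propositional logic $\mathsf{IPC}$. For every formula $\phi$ of the team language whose propositional variables are among $p_1,\dots,p_n$, $$\mathcal{U}(n)\models_{\mathsf{t}}\phi\iff\ \vdash_{\mathsf{tIPC}}\phi .$$
   Context: **Language.** Fix a set $\mathsf{Prop}$ of propositional variables. Formulas of the team language are $\phi::=p\mid\bot\mid\phi\wedge\phi\mid\phi\vee\phi\mid\phi\veebar\phi\mid\phi\to\phi$ with $p\in\mathsf{Prop}$; $\vee$ is the local disjunction and $\veebar$ the global disjunction. Formulas without $\veebar$ are called standard formulas. **Models.** An intuitionistic Kripke model is $\mathfrak{M}=(W,R,V)$ with $W\neq\varnothing$, $R$ a partial order on $W$, and $V:\mathsf{Prop}\to\wp(W)$ persistent ($w\in V(p)$ and $wRv$ imply $v\in V(p)$). An $n$-model is a model whose valuation is restricted to $p_1,\dots,p_n$. An immediate successor of $w$ is a proper successor $v$ of $w$ with no point strictly between $w$ and $v$; $\lceil w\rceil$ is the set of immediate successors of $w$. **Team semantics.** A team is a set $t\subseteq W$. For teams, $tR^\circ s$ iff $\forall w\in t\,\exists v\in s\,(wRv)$ and $\forall v\in s\,\exists w\in t\,(wRv)$. Write $t\supseteq\circ R^\circ s$ iff there is $r\subseteq W$ with $t\supseteq r$ and $rR^\circ s$. Satisfaction: - $\mathfrak{M},t\models p$ iff $t\subseteq V(p)$; - $\mathfrak{M},t\models\bot$ iff $t=\varnothing$; - $\mathfrak{M},t\models\phi\wedge\psi$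 iff $\mathfrak{M},t\models\phi$ and $\mathfrak{M},t\models\psi$; - $\mathfrak{M},t\models\phi\vee\psi$ iff there are $s,r\subseteq W$ with $t\subseteq s\cup r$, $\mathfrak{M},s\models\phi$ and $\mathfrak{M},r\models\psi$; - $\mathfrak{M},t\models\phi\veebar\psi$ iff $\mathfrak{M},t\models\phi$ or $\mathfrak{M},t\models\psi$; - $\mathfrak{M},t\models\phi\to\psi$ iff for all $s\subseteq W$ with $t\supseteq\circ R^\circ s$, $\mathfrak{M},s\models\phi$ implies $\mathfrak{M},s\models\psi$. $\mathfrak{M}\models_{\mathsf{t}}\phi$ means $\mathfrak{M},t\models\phi$ for all teams $t\subseteq W$. **The system $\mathsf{tIPC}$.** This is the Hilbert system with Modus Ponens as its rule and the following axioms, where $\phi,\psi,\chi$ are arbitrary formulas and $\alpha$ is an arbitrary standard formula: 1. $\phi\to\phi\vee\psi$; 2. $(\phi\to\alpha)\to((\psi\to\alpha)\to(\phi\vee\psi\to\alpha))$; 3. $(\phi\to\chi)\to(\phi\vee\psi\to\chi\vee\psi)$; 4. $\phi\vee\psi\to\psi\vee\phi$; 5. $(\phi\vee\psi)\vee\chi\to\phi\vee(\psi\vee\chi)$; 6. $\phi\vee(\psi\veebar\chi)\to(\phi\vee\psi)\veebar(\phi\vee\chi)$; 7. $\phi\to(\psi\to\phi)$; $(\phi\to(\psi\to\chi))\to((\phi\to\psi)\to(\phi\to\chi))$; $(\phi\wedge\psi)\to\phi$; $(\phi\wedge\psi)\to\psi$; $\phi\to(\psi\to(\phi\wedge\psi))$;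 $\phi\to(\phi\veebar\psi)$; $\psi\to(\phi\veebar\psi)$; $(\phi\to\chi)\to((\psi\to\chi)\to((\phi\veebar\psi)\to\chi))$; $\bot\to\phi$; 8. $(\alpha\to\phi\veebar\psi)\to(\alpha\to\phi)\veebar(\alpha\to\psi)$. $\vdash_{\mathsf{tIPC}}\phi$ means $\phi$ is derivable in this system. **Universal model.** The color of a point $w$ in an $n$-model is the sequence $col(w)=c_1\dots c_n\in\{0,1\}^n$ with $c_i=1$ iff $w\in V(p_i)$. Colors are ordered componentwise by $\leq$, with strict part $<$. The $n$-universal model $\mathcal{U}(n)=(W,R,V)$ is built inductively in layers; $R$ is the reflexive transitive closure of the immediate-successor relation specified. The first layer consists of $2^n$ nodes of pairwise distinct colors (one for each color), without proper successors. Given layers $\leq k$, layer $k+1$ consists of: (i) for every node $w$ in layer $k$ and every color $c<col(w)$, a new node $v$ with $col(v)=c$ and $\lceil v\rceil=\{w\}$; (ii) for every finite set $A$ of at least two pairwise $R$-incomparable nodes from layers $\leq k$, at least one of which is in layer $k$, and every color $c$ with $c\leq col(w)$ for all $w\in A$, a new node $v$ with $col(v)=c$ and $\lceil v\rceil=A$. -}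

module Defs where

import Data.Bool as Bool
import Data.Bool.Properties as Bool
import Data.Vec.Relation.Binary.Lex.Strict as VecLex
open import Data.Bool using (Bool; true)
open import Data.Fin using (Fin)
open import Data.List using (List; []; _∷_; [_]; length)
open import Data.List.Membership.Propositional using (_∈_)
open import Data.List.Relation.Binary.Lex.Strict using (Lex-<; halt; this; next)
open import Data.List.Relation.Unary.All as All using (All)
open import Data.List.Relation.Unary.AllPairs using (AllPairs)
open import Data.List.Relation.Unary.Any using (Any; here; there)
open import Data.Nat using (ℕ; suc; _≤_; _<_; _⊔_; s≤s)
import Data.Nat.Properties as ℕ
open import Data.Product using (∃-syntax; Σ-syntax; _×_; _,_)
open import Data.Sum using (_⊎_; inj₁; inj₂)
open import Data.Vec using (Vec; lookup; replicate)
open import Data.Vec.Relation.Binary.Pointwise.Inductive as Pointwise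
  using (Pointwise; Pointwise-≡⇒≡; ≡⇒Pointwise-≡)
open import Function using (_∘_)
open import Level using (Lift; 0ℓ)
open import Relation.Binary
  using (Rel; IsPartialOrder; IsStrictTotalOrder; Antisymmetric;
         Trichotomous; tri<; tri≈; tri>)
open import Relation.Binary.Construct.Closure.ReflexiveTransitive
  using (Star; ε; _◅_; _◅◅_)
open import Relation.Binary.PropositionalEquality
  using (_≡_; _≢_; refl; sym; isEquivalence; resp₂)
open import Relation.Nullary using (¬_; contradiction)
open import Relation.Nullary.Decidable using (recompute)
open import Relation.Unary using (Pred; Empty; _⊆_; _∪_)

------------------------------------------------------------------------
-- Language

infixr 7 _∧_
infixr 6 _∨_ _⊻_
infixr 5 _⇒_

-- _∨_ is the local disjunction, _⊻_ the global one.
data Formula (X : Set) : Set where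
  var             : X → Formula X
  ⊥               : Formula X
  _∧_ _∨_ _⊻_ _⇒_ : Formula X → Formula X → Formula X

data Standard {X : Set} : Formula X → Set where
  var : ∀ x → Standard (var x)
  ⊥   : Standard ⊥
  _∧_ : ∀ {α β} → Standard α → Standard β → Standard (α ∧ β)
  _∨_ : ∀ {α β} → Standard α → Standard β → Standard (α ∨ β)
  _⇒_ : ∀ {α β} → Standard α → Standard β → Standard (α ⇒ β)

rename : {X Y : Set} → (X → Y) → Formula X → Formula Y
rename f (var x) = var (f x)
rename f ⊥       = ⊥
rename f (φ ∧ ψ) = rename f φ ∧ rename f ψ
rename f (φ ∨ ψ) = rename f φ ∨ rename f ψ
rename f (φ ⊻ ψ) = rename f φ ⊻ rename f ψ
rename f (φ ⇒ ψ) = rename f φ ⇒ rename f ψ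

------------------------------------------------------------------------
-- Models and team semantics

record Model (X : Set) : Set₁ where
  field
    W              : Set
    point          : W
    R              : Rel W 0ℓ
    isPartialOrder : IsPartialOrder _≡_ R
    V              : X → Pred W 0ℓ
    persistent     : ∀ {x w v} → V x w → R w v → V x v

module _ {X : Set} (M : Model X) where
  open Model M

  Team : Set₁
  Team = Pred W 0ℓ

  R° : Team → Team → Set
  R° t s = (∀ w → t w → ∃[ v ] s v × R w v) × (∀ v → s v → ∃[ w ] t w × R w v)

  ⊇∘R° : Team → Team → Set₁
  ⊇∘R° t s = Σ[ r ∈ Team ] r ⊆ t × R° r s

  Sat : Team → Formula X → Set₁
  Sat t (var x) = Lift _ (t ⊆ V x)
  Sat t ⊥       = Lift _ (Empty t)
  Sat t (φ ∧ ψ) = Sat t φ × Sat t ψ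
  Sat t (φ ∨ ψ) = Σ[ s ∈ Team ] Σ[ r ∈ Team ] t ⊆ s ∪ r × Sat s φ × Sat r ψ
  Sat t (φ ⊻ ψ) = Sat t φ ⊎ Sat t ψ
  Sat t (φ ⇒ ψ) = ∀ (s : Team) → ⊇∘R° t s → Sat s φ → Sat s ψ

infix 4 _⊨ₜ_

_⊨ₜ_ : {X : Set} → Model X → Formula X → Set₁
M ⊨ₜ φ = ∀ (t : Team M) → Sat M t φ

------------------------------------------------------------------------
-- The system tIPC

infix 4 ⊢_

data ⊢_ {X : Set} : Formula X → Set where
  mp : ∀ {φ ψ} → ⊢ φ ⇒ ψ → ⊢ φ → ⊢ ψ

  ∨-intro : ∀ φ ψ → ⊢ φ ⇒ (φ ∨ ψ)
  ∨-elim  : ∀ φ ψ {α} → Standard α → ⊢ (φ ⇒ α) ⇒ ((ψ ⇒ α) ⇒ ((φ ∨ ψ) ⇒ α))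
  ∨-mono  : ∀ φ ψ χ → ⊢ (φ ⇒ χ) ⇒ ((φ ∨ ψ) ⇒ (χ ∨ ψ))
  ∨-comm  : ∀ φ ψ → ⊢ (φ ∨ ψ) ⇒ (ψ ∨ φ)
  ∨-assoc : ∀ φ ψ χ → ⊢ ((φ ∨ ψ) ∨ χ) ⇒ (φ ∨ (ψ ∨ χ))
  ∨-⊻     : ∀ φ ψ χ → ⊢ (φ ∨ (ψ ⊻ χ)) ⇒ ((φ ∨ ψ) ⊻ (φ ∨ χ))

  K        : ∀ φ ψ → ⊢ φ ⇒ (ψ ⇒ φ)
  S        : ∀ φ ψ χ → ⊢ (φ ⇒ (ψ ⇒ χ)) ⇒ ((φ ⇒ ψ) ⇒ (φ ⇒ χ))
  ∧-elimˡ  : ∀ φ ψ → ⊢ (φ ∧ ψ) ⇒ φ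
  ∧-elimʳ  : ∀ φ ψ → ⊢ (φ ∧ ψ) ⇒ ψ
  ∧-intro  : ∀ φ ψ → ⊢ φ ⇒ (ψ ⇒ (φ ∧ ψ))
  ⊻-introˡ : ∀ φ ψ → ⊢ φ ⇒ (φ ⊻ ψ)
  ⊻-introʳ : ∀ φ ψ → ⊢ ψ ⇒ (φ ⊻ ψ)
  ⊻-elim   : ∀ φ ψ χ → ⊢ (φ ⇒ χ) ⇒ ((ψ ⇒ χ) ⇒ ((φ ⊻ ψ) ⇒ χ))
  ⊥-elim   : ∀ φ → ⊢ ⊥ ⇒ φ

  split : ∀ {α} → Standard α → ∀ φ ψ → ⊢ (α ⇒ (φ ⊻ ψ)) ⇒ ((α ⇒ φ) ⊻ (α ⇒ ψ))

------------------------------------------------------------------------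
-- The n-universal model

Colour : ℕ → Set
Colour n = Vec Bool n

module _ {n : ℕ} where

  infix 4 _≤ᶜ_ _<ᶜ_

  _≤ᶜ_ _<ᶜ_ : Rel (Colour n) 0ℓ
  _≤ᶜ_ = Pointwise Bool._≤_
  c <ᶜ d = c ≤ᶜ d × c ≢ d

-- A node of the universal model is determined by its colour and its finite
-- set of immediate successors, so nodes are represented by finitely branching
-- trees; `Layer` below selects the trees that do represent nodes.
data Tree (n : ℕ) : Set where
  node : Colour n → List (Tree n) → Tree n

module _ {n : ℕ} where

  col : Tree n → Colour n
  col (node c A) = c

  succs : Tree n → List (Tree n)
  succs (node c A) = A

  infix 4 _⟶_ _⟶*_ _<ₜ_

  _⟶_ _⟶*_ : Rel (Tree n) 0ℓ
  w ⟶ v = v ∈ succs w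
  _⟶*_ = Star _⟶_

  -- An auxiliary strict total order (see `<ₜ-isStrictTotalOrder`), unrelated
  -- to the accessibility relation. It is used only to represent each finite
  -- set of trees by exactly one list: the one that is strictly increasing.
  data _<ₜ_ : Rel (Tree n) 0ℓ where
    colour   : ∀ {c d A B} → VecLex.Lex-< _≡_ Bool._<_ c d → node c A <ₜ node d B
    children : ∀ {c A B} → Lex-< _≡_ _<ₜ_ A B → node c A <ₜ node c B

  Increasing : Pred (List (Tree n)) 0ℓ
  Increasing = AllPairs _<ₜ_

  Incomparable : Rel (Tree n) 0ℓ
  Incomparable w v = ¬ (w ⟶* v) × ¬ (v ⟶* w)

  -- `Layer k w`: w is a node of the k-th layer, counting from 1.
  data Layer : ℕ → Tree n → Set where
    first  : ∀ c → Layer 1 (node c [])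
    single : ∀ {k w c} → Layer k w → c <ᶜ col w → Layer (suc k) (node c [ w ])
    branch : ∀ {k A c} →
             Increasing A →
             2 ≤ length A →
             AllPairs Incomparable A →
             All (λ w → ∃[ j ] j ≤ k × Layer j w) A →
             Any (Layer k) A →
             All (λ w → c ≤ᶜ col w) A →
             Layer (suc k) (node c A)

-- Irrelevance of the second field makes nodes with equal trees equal.
record Node (n : ℕ) : Set where
  constructor mkNode
  field
    tree     : Tree n
    .layered : ∃[ k ] Layer k tree

module _ {n : ℕ} where

  private
    module C = IsStrictTotalOrder
      (VecLex.<-isStrictTotalOrder Bool.<-isStrictTotalOrder {n})

  irreflₜ : ∀ {w : Tree n} → ¬ (w <ₜ w)
  irrefl* : ∀ {A : List (Tree n)} → ¬ Lex-< _≡_ _<ₜ_ A A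
  irreflₜ (colour c<c)   = C.irrefl (≡⇒Pointwise-≡ refl) c<c
  irreflₜ (children A<A) = irrefl* A<A
  irrefl* (this w<w)     = irreflₜ w<w
  irrefl* (next _ A<A)   = irrefl* A<A

  transₜ : {u v w : Tree n} → u <ₜ v → v <ₜ w → u <ₜ w
  trans* : {A B D : List (Tree n)} →
           Lex-< _≡_ _<ₜ_ A B → Lex-< _≡_ _<ₜ_ B D → Lex-< _≡_ _<ₜ_ A D
  transₜ (colour p)   (colour q)   = colour (C.trans p q)
  transₜ (colour p)   (children _) = colour p
  transₜ (children _) (colour q)   = colour q
  transₜ (children p) (children q) = children (trans* p q)
  trans* halt          (this _)      = halt
  trans* halt          (next _ _)    = halt
  trans* (this p)      (this q)      = this (transₜ p q)
  trans* (this p)      (next refl _) = this p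
  trans* (next refl _) (this q)      = this q
  trans* (next refl p) (next refl q) = next refl (trans* p q)

  connexₜ : (w v : Tree n) → w <ₜ v ⊎ w ≡ v ⊎ v <ₜ w
  connex* : (A B : List (Tree n)) →
            Lex-< _≡_ _<ₜ_ A B ⊎ A ≡ B ⊎ Lex-< _≡_ _<ₜ_ B A
  connexₜ (node c A) (node d B) with C.compare c d
  ... | tri< p _ _ = inj₁ (colour p)
  ... | tri> _ _ p = inj₂ (inj₂ (colour p))
  ... | tri≈ _ c≡d _ with Pointwise-≡⇒≡ c≡d | connex* A B
  ...   | refl | inj₁ p           = inj₁ (children p)
  ...   | refl | inj₂ (inj₁ refl) = inj₂ (inj₁ refl)
  ...   | refl | inj₂ (inj₂ p)    = inj₂ (inj₂ (children p))
  connex* []      []      = inj₂ (inj₁ refl)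
  connex* []      (_ ∷ _) = inj₁ halt
  connex* (_ ∷ _) []      = inj₂ (inj₂ halt)
  connex* (w ∷ A) (v ∷ B) with connexₜ w v | connex* A B
  ... | inj₁ p           | _                = inj₁ (this p)
  ... | inj₂ (inj₂ p)    | _                = inj₂ (inj₂ (this p))
  ... | inj₂ (inj₁ refl) | inj₁ p           = inj₁ (next refl p)
  ... | inj₂ (inj₁ refl) | inj₂ (inj₁ refl) = inj₂ (inj₁ refl)
  ... | inj₂ (inj₁ refl) | inj₂ (inj₂ p)    = inj₂ (inj₂ (next refl p))

  compareₜ : Trichotomous _≡_ (_<ₜ_ {n})
  compareₜ w v with connexₜ w v
  ... | inj₁ p           = tri< p (λ { refl → irreflₜ p }) (irreflₜ ∘ transₜ p)
  ... | inj₂ (inj₁ refl) = tri≈ irreflₜ refl irreflₜ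
  ... | inj₂ (inj₂ p)    = tri> (irreflₜ ∘ transₜ p) (λ { refl → irreflₜ p }) p

  <ₜ-isStrictTotalOrder : IsStrictTotalOrder _≡_ (_<ₜ_ {n})
  <ₜ-isStrictTotalOrder = record
    { isStrictPartialOrder = record
      { isEquivalence = isEquivalence
      ; irrefl        = λ { refl → irreflₜ }
      ; trans         = transₜ
      ; <-resp-≈      = resp₂ _<ₜ_
      }
    ; compare = compareₜ
    }

  height  : Tree n → ℕ
  height* : List (Tree n) → ℕ
  height (node c A) = suc (height* A)
  height* []        = 0
  height* (w ∷ A)   = height w ⊔ height* A

  ∈-height : ∀ {w} {A : List (Tree n)} → w ∈ A → height w ≤ height* A
  ∈-height (here refl)         = ℕ.m≤m⊔n _ _
  ∈-height {A = v ∷ A} (there w∈A) = ℕ.≤-trans (∈-height w∈A) (ℕ.m≤n⊔m (height v) _)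

  ⟶*-height : {w v : Tree n} → w ⟶* v → w ≡ v ⊎ height v < height w
  ⟶*-height ε = inj₁ refl
  ⟶*-height {node c A} (s ◅ r) with ⟶*-height r
  ... | inj₁ refl = inj₂ (s≤s (∈-height s))
  ... | inj₂ v<u  = inj₂ (ℕ.<-trans v<u (s≤s (∈-height s)))

  ⟶*-antisym : Antisymmetric _≡_ (_⟶*_ {n})
  ⟶*-antisym r s with ⟶*-height r | ⟶*-height s
  ... | inj₁ w≡v | _        = w≡v
  ... | inj₂ _   | inj₁ v≡w = sym v≡w
  ... | inj₂ v<w | inj₂ w<v = contradiction v<w (ℕ.<-asym w<v)

  ⟶-layered : ∀ {k} {w v : Tree n} → Layer k w → w ⟶ v → (∃[ j ] Layer j v) × col w ≤ᶜ col v
  ⟶-layered (single l (c≤d , _)) (here refl) = (_ , l) , c≤d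
  ⟶-layered (branch _ _ _ ls _ cs) s =
    let j , _ , l = All.lookup ls s in (j , l) , All.lookup cs s

  true-mono : ∀ {b c} → b Bool.≤ c → b ≡ true → c ≡ true
  true-mono Bool.b≤b eq = eq

  ⟶*-persistent : ∀ {i} {w v : Tree n} → (∃[ k ] Layer k w) → w ⟶* v →
                  lookup (col w) i ≡ true → lookup (col v) i ≡ true
  ⟶*-persistent l ε h = h
  ⟶*-persistent {i} (_ , l) (s ◅ r) h =
    let l′ , c≤d = ⟶-layered l s
    in ⟶*-persistent l′ r (true-mono (Pointwise.lookup c≤d i) h)

open Node

-- Every tree reachable from a layered tree is layered, so restricting _⟶*_ to
-- nodes gives the reflexive transitive closure of _⟶_ on nodes.
𝒰 : (n : ℕ) → Model (Fin n)
𝒰 n = record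
  { W              = Node n
  ; point          = mkNode (node (replicate n true) []) (1 , first _)
  ; R              = λ w v → tree w ⟶* tree v
  ; isPartialOrder = record
    { isPreorder = record
      { isEquivalence = isEquivalence
      ; reflexive     = λ { refl → ε }
      ; trans         = _◅◅_
      }
    ; antisym = λ r s → tree-injective (⟶*-antisym r s)
    }
  ; V              = λ i w → lookup (col (tree w)) i ≡ true
  ; persistent     = λ { {i} {mkNode w l} {v} h r →
      recompute (lookup (col (tree v)) i Bool.≟ true) (⟶*-persistent l r h) }
  }
  where
  tree-injective : {w v : Node n} → tree w ≡ tree v → w ≡ v
  tree-injective refl = refl

{-# OPTIONS --safe #-}
module Submission where

open import Defs
open import Data.Nat using (ℕ)
open import Data.Fin using (Fin)
open import Function.Bundles using (_⇔_)
open import Function.Definitions using (Injective)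
open import Relation.Binary.PropositionalEquality using (_≡_)

import Data.Bool as Bool
import Data.Bool.Properties as Bool
import Data.Empty as Empty
import Data.List.Relation.Unary.All.Properties as All
import Data.List.Relation.Unary.AllPairs.Properties as AllPairs
import Data.List.Relation.Unary.Any.Properties as Any
import Data.Nat.Properties as ℕ
import Data.Vec.Relation.Binary.Pointwise.Inductive as Pointwise
open import Data.Bool using (true; false)
open import Data.Fin using (zero; suc; _↑ˡ_; _↑ʳ_; splitAt)
open import Data.Fin.Properties using (any?; splitAt-↑ˡ; splitAt-↑ʳ)
open import Data.Fin.Subset as Subset using (Subset; inside; outside; _⊂_)
  renaming (_∈_ to _∈ₛ_; _∉_ to _∉ₛ_; _⊆_ to _⊆ₛ_)
open import Data.Fin.Subset.Induction using (Acc; acc; ⊃-wellFounded)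
open import Data.Fin.Subset.Properties using (⊆-antisym; _⊂?_) renaming (_∈?_ to _∈ₛ?_)
open import Data.List using (List; []; _∷_; _++_; map; filter; length; lookup)
open import Data.List.Membership.Propositional using (_∈_; find; lose)
open import Data.List.Membership.Propositional.Properties
  using (∈-map⁺; ∈-filter⁺; ∈-lookup; ∈-++⁺ˡ; ∈-++⁺ʳ)
open import Data.List.Relation.Unary.All as All using (All; []; _∷_)
open import Data.List.Relation.Unary.AllPairs using (AllPairs; []; _∷_)
open import Data.List.Relation.Unary.Any as Any using (Any; here; there)
open import Data.Nat using (zero; suc; _+_; _≤_; s≤s; z≤n)
open import Data.Product using (Σ-syntax; ∃; ∃-syntax; _×_; _,_; proj₁; proj₂; swap)
open import Data.Sum as Sum using (_⊎_; inj₁; inj₂; [_,_]′)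
open import Data.Vec as Vec using ([]; _∷_)
open import Data.Vec.Properties using (≡-dec; lookup∘tabulate; []=⇒lookup; lookup⇒[]=)
open import Function using (_∘_; id)
open import Function.Bundles using (mk⇔)
open import Level using (lift; 0ℓ)
open import Relation.Binary using (IsPartialOrder; IsStrictTotalOrder)
open import Relation.Binary.Construct.Closure.ReflexiveTransitive using (ε; _◅_; _◅◅_)
open import Relation.Binary.PropositionalEquality using (refl; sym; trans; cong; subst)
open import Relation.Nullary using (¬_; Dec; yes; no; contradiction; ¬?; _×-dec_; _⊎-dec_)
open import Relation.Nullary.Decidable using (map′; decidable-stable)
open import Relation.Unary using (Pred; ∅; U; _⊆_; _∪_; _∩_; ｛_｝)

-- Soundness holds in every model; variables outside the image of p are interpreted as empty.
-- Conversely, every formula is provably equivalent to a ⊻-disjunction of standard formulas. If it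
-- holds at the full team of 𝒰 n, so does one of the disjuncts α, which is then forced at every
-- point. To derive α, consider the truth assignments Γ to the variables and to the implications
-- occurring in α. By induction on Γ ordered by ⊃, each Γ is either refutable or the theory of a
-- point of 𝒰 n, namely a highest point of colour Γ below the points realising the larger
-- assignments that witness the failure of the implications false in Γ. As α is forced everywhere,
-- all assignments making α false are refutable, whence ⊢ α. All case distinctions are decidable.

-- Derivations from hypotheses

infix 4 _⊢ʰ_

data _⊢ʰ_ {X : Set} (H : Pred (Formula X) 0ℓ) : Formula X → Set where
  hyp : ∀ {φ} → H φ → H ⊢ʰ φ
  thm : ∀ {φ} → ⊢ φ → H ⊢ʰ φ
  app : ∀ {φ ψ} → H ⊢ʰ φ ⇒ ψ → H ⊢ʰ φ → H ⊢ʰ ψ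

module _ {X : Set} where

  infix 4 _⊣⊢_
  infixl 5 _▸_

  private
    variable
      φ ψ χ φ′ ψ′ : Formula X
      H H′ : Pred (Formula X) 0ℓ

  _▸_ : Pred (Formula X) 0ℓ → Formula X → Pred (Formula X) 0ℓ
  H ▸ φ = H ∪ ｛ φ ｝

  ⇒-refl : (φ : Formula X) → ⊢ φ ⇒ φ
  ⇒-refl φ = mp (mp (S φ (φ ⇒ φ) φ) (K φ (φ ⇒ φ))) (K φ φ)

  deduction : H ▸ φ ⊢ʰ ψ → H ⊢ʰ φ ⇒ ψ
  deduction (hyp (inj₁ h))    = app (thm (K _ _)) (hyp h)
  deduction (hyp (inj₂ refl)) = thm (⇒-refl _)
  deduction (thm d)           = app (thm (K _ _)) (thm d)
  deduction (app d e)         = app (app (thm (S _ _ _)) (deduction d)) (deduction e)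

  cut : (∀ {φ} → H φ → H′ ⊢ʰ φ) → H ⊢ʰ ψ → H′ ⊢ʰ ψ
  cut f (hyp h)   = f h
  cut f (thm d)   = thm d
  cut f (app d e) = app (cut f d) (cut f e)

  weaken : H ⊆ H′ → H ⊢ʰ ψ → H′ ⊢ʰ ψ
  weaken H⊆H′ = cut (hyp ∘ H⊆H′)

  discharge : ∅ ⊢ʰ φ → ⊢ φ
  discharge (thm d)   = d
  discharge (app d e) = mp (discharge d) (discharge e)

  ⇒-intro : ∅ ▸ φ ⊢ʰ ψ → ⊢ φ ⇒ ψ
  ⇒-intro = discharge ∘ deduction

  last : H ▸ φ ⊢ʰ φ
  last = hyp (inj₂ refl)

  ⇒-trans : ⊢ φ ⇒ ψ → ⊢ ψ ⇒ χ → ⊢ φ ⇒ χ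
  ⇒-trans d e = ⇒-intro (app (thm e) (app (thm d) last))

  pairʰ : H ⊢ʰ φ → H ⊢ʰ ψ → H ⊢ʰ φ ∧ ψ
  pairʰ d e = app (app (thm (∧-intro _ _)) d) e

  fstʰ : H ⊢ʰ φ ∧ ψ → H ⊢ʰ φ
  fstʰ = app (thm (∧-elimˡ _ _))

  sndʰ : H ⊢ʰ φ ∧ ψ → H ⊢ʰ ψ
  sndʰ = app (thm (∧-elimʳ _ _))

  injˡʰ : H ⊢ʰ φ → H ⊢ʰ φ ⊻ ψ
  injˡʰ = app (thm (⊻-introˡ _ _))

  injʳʰ : H ⊢ʰ ψ → H ⊢ʰ φ ⊻ ψ
  injʳʰ = app (thm (⊻-introʳ _ _))

  caseʰ : H ⊢ʰ φ ⊻ ψ → H ▸ φ ⊢ʰ χ → H ▸ ψ ⊢ʰ χ → H ⊢ʰ χ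
  caseʰ d e f = app (app (app (thm (⊻-elim _ _ _)) (deduction e)) (deduction f)) d

  ∨-introʳ : ∀ φ ψ → ⊢ ψ ⇒ φ ∨ ψ
  ∨-introʳ φ ψ = ⇒-trans (∨-intro ψ φ) (∨-comm ψ φ)

  ∨-monoˡ : ⊢ φ ⇒ ψ → ⊢ φ ∨ χ ⇒ ψ ∨ χ
  ∨-monoˡ = mp (∨-mono _ _ _)

  ∨-monoʳ : ⊢ φ ⇒ ψ → ⊢ χ ∨ φ ⇒ χ ∨ ψ
  ∨-monoʳ d = ⇒-trans (∨-comm _ _) (⇒-trans (∨-monoˡ d) (∨-comm _ _))

  ⊻-case : ⊢ φ ⇒ χ → ⊢ ψ ⇒ χ → ⊢ φ ⊻ ψ ⇒ χ
  ⊻-case d e = mp (mp (⊻-elim _ _ _) d) e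

  ⊻-map : ⊢ φ ⇒ φ′ → ⊢ ψ ⇒ ψ′ → ⊢ φ ⊻ ψ ⇒ φ′ ⊻ ψ′
  ⊻-map d e = ⊻-case (⇒-trans d (⊻-introˡ _ _)) (⇒-trans e (⊻-introʳ _ _))

  ∧-map : ⊢ φ ⇒ φ′ → ⊢ ψ ⇒ ψ′ → ⊢ φ ∧ ψ ⇒ φ′ ∧ ψ′
  ∧-map d e = ⇒-intro (pairʰ (app (thm d) (fstʰ last)) (app (thm e) (sndʰ last)))

  ∨-map : ⊢ φ ⇒ φ′ → ⊢ ψ ⇒ ψ′ → ⊢ φ ∨ ψ ⇒ φ′ ∨ ψ′
  ∨-map d e = ⇒-trans (∨-monoˡ d) (∨-monoʳ e)

  ⇒-map : ⊢ φ′ ⇒ φ → ⊢ ψ ⇒ ψ′ → ⊢ (φ ⇒ ψ) ⇒ (φ′ ⇒ ψ′)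
  ⇒-map d e = ⇒-intro (deduction (app (thm e) (app (hyp (inj₁ (inj₂ refl))) (app (thm d) last))))

-- Disjunctive normal form

  _⊣⊢_ : Formula X → Formula X → Set
  φ ⊣⊢ ψ = (⊢ φ ⇒ ψ) × (⊢ ψ ⇒ φ)

  data Normal : Formula X → Set where
    leaf : ∀ {α} → Standard α → Normal α
    _⊻_  : ∀ {φ ψ} → Normal φ → Normal ψ → Normal (φ ⊻ ψ)

  Normalisable : Formula X → Set
  Normalisable φ = ∃[ ψ ] Normal ψ × ψ ⊣⊢ φ

  normal : Normal φ → Normalisable φ
  normal N = _ , N , ⇒-refl _ , ⇒-refl _

  normalisable-cong : φ ⊣⊢ ψ → Normalisable φ → Normalisable ψ
  normalisable-cong (f , g) (_ , N , d , e) = _ , N , ⇒-trans d f , ⇒-trans g e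

  normalisable-⊻ : Normalisable φ → Normalisable ψ → Normalisable (φ ⊻ ψ)
  normalisable-⊻ (_ , N , d , e) (_ , N′ , d′ , e′) = _ , N ⊻ N′ , ⊻-map d d′ , ⊻-map e e′

  -- Conjunction and local disjunction turn `⊻` in the left argument into `⊻`, whereas implication
  -- turns it into a conjunction; hence the left step is the parameter `leftward`. `distribˡ` asks
  -- for a standard `α`, as `split` does for implication.
  module Distribute
    (_∙_ : Formula X → Formula X → Formula X)
    (standard : ∀ {α β} → Standard α → Standard β → Standard (α ∙ β))
    (distribˡ : ∀ {α} → Standard α → ∀ φ ψ → ((α ∙ φ) ⊻ (α ∙ ψ)) ⊣⊢ (α ∙ (φ ⊻ ψ)))
    (leftward : ∀ φ ψ χ → Normalisable (φ ∙ χ) → Normalisable (ψ ∙ χ) → Normalisable ((φ ⊻ ψ) ∙ χ))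
    where

    distribute : Normal φ → Normal ψ → Normalisable (φ ∙ ψ)
    distribute (leaf α) (leaf β) = normal (leaf (standard α β))
    distribute (leaf α) (N ⊻ N′) =
      normalisable-cong (distribˡ α _ _)
        (normalisable-⊻ (distribute (leaf α) N) (distribute (leaf α) N′))
    distribute (M ⊻ M′) N        = leftward _ _ _ (distribute M N) (distribute M′ N)

  ∧-distribˡ : ∀ φ ψ χ → ((χ ∧ φ) ⊻ (χ ∧ ψ)) ⊣⊢ (χ ∧ (φ ⊻ ψ))
  ∧-distribˡ φ ψ χ =
    ⊻-case (∧-map (⇒-refl _) (⊻-introˡ _ _)) (∧-map (⇒-refl _) (⊻-introʳ _ _)) ,
    ⇒-intro (caseʰ (sndʰ last)
      (injˡʰ (pairʰ (fstʰ (hyp (inj₁ (inj₂ refl)))) last))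
      (injʳʰ (pairʰ (fstʰ (hyp (inj₁ (inj₂ refl)))) last)))

  ∧-distribʳ : ∀ φ ψ χ → ((φ ∧ χ) ⊻ (ψ ∧ χ)) ⊣⊢ ((φ ⊻ ψ) ∧ χ)
  ∧-distribʳ φ ψ χ =
    ⊻-case (∧-map (⊻-introˡ _ _) (⇒-refl _)) (∧-map (⊻-introʳ _ _) (⇒-refl _)) ,
    ⇒-intro (caseʰ (fstʰ last)
      (injˡʰ (pairʰ last (sndʰ (hyp (inj₁ (inj₂ refl))))))
      (injʳʰ (pairʰ last (sndʰ (hyp (inj₁ (inj₂ refl)))))))

  ∨-distribˡ : ∀ φ ψ χ → ((χ ∨ φ) ⊻ (χ ∨ ψ)) ⊣⊢ (χ ∨ (φ ⊻ ψ))
  ∨-distribˡ φ ψ χ =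
    ⊻-case (∨-monoʳ (⊻-introˡ _ _)) (∨-monoʳ (⊻-introʳ _ _)) , ∨-⊻ χ φ ψ

  ∨-distribʳ : ∀ φ ψ χ → ((φ ∨ χ) ⊻ (ψ ∨ χ)) ⊣⊢ ((φ ⊻ ψ) ∨ χ)
  ∨-distribʳ φ ψ χ =
    ⊻-case (∨-monoˡ (⊻-introˡ _ _)) (∨-monoˡ (⊻-introʳ _ _)) ,
    ⇒-trans (∨-comm _ _) (⇒-trans (∨-⊻ χ φ ψ) (⊻-map (∨-comm _ _) (∨-comm _ _)))

  ⇒-distribˡ : ∀ {α} → Standard α → ∀ φ ψ → ((α ⇒ φ) ⊻ (α ⇒ ψ)) ⊣⊢ (α ⇒ (φ ⊻ ψ))
  ⇒-distribˡ α φ ψ =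
    ⊻-case (⇒-map (⇒-refl _) (⊻-introˡ _ _)) (⇒-map (⇒-refl _) (⊻-introʳ _ _)) , split α φ ψ

  ⇒-⊻-∧ : ∀ φ ψ χ → ((φ ⇒ χ) ∧ (ψ ⇒ χ)) ⊣⊢ ((φ ⊻ ψ) ⇒ χ)
  ⇒-⊻-∧ φ ψ χ =
    ⇒-intro (app (app (thm (⊻-elim _ _ _)) (fstʰ last)) (sndʰ last)) ,
    ⇒-intro (pairʰ (app (thm (⇒-map (⊻-introˡ _ _) (⇒-refl _))) last)
                   (app (thm (⇒-map (⊻-introʳ _ _) (⇒-refl _))) last))

  normalisable-∧ : Normalisable φ → Normalisable ψ → Normalisable (φ ∧ ψ)
  normalisable-∧ (_ , N , d , e) (_ , N′ , d′ , e′) =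
    normalisable-cong (∧-map d d′ , ∧-map e e′) (distribute N N′)
    where
    open Distribute _∧_ _∧_ (λ _ φ ψ → ∧-distribˡ φ ψ _)
      (λ φ ψ χ r s → normalisable-cong (∧-distribʳ φ ψ χ) (normalisable-⊻ r s))

  normalisable-∨ : Normalisable φ → Normalisable ψ → Normalisable (φ ∨ ψ)
  normalisable-∨ (_ , N , d , e) (_ , N′ , d′ , e′) =
    normalisable-cong (∨-map d d′ , ∨-map e e′) (distribute N N′)
    where
    open Distribute _∨_ _∨_ (λ _ φ ψ → ∨-distribˡ φ ψ _)
      (λ φ ψ χ r s → normalisable-cong (∨-distribʳ φ ψ χ) (normalisable-⊻ r s))

  normalisable-⇒ : Normalisable φ → Normalisable ψ → Normalisable (φ ⇒ ψ)
  normalisable-⇒ (_ , N , d , e) (_ , N′ , d′ , e′) =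
    normalisable-cong (⇒-map e d′ , ⇒-map d e′) (distribute N N′)
    where
    open Distribute _⇒_ _⇒_ ⇒-distribˡ
      (λ φ ψ χ r s → normalisable-cong (⇒-⊻-∧ φ ψ χ) (normalisable-∧ r s))

  normalise : ∀ φ → Normalisable φ
  normalise (var x) = normal (leaf (var x))
  normalise ⊥       = normal (leaf ⊥)
  normalise (φ ∧ ψ) = normalisable-∧ (normalise φ) (normalise ψ)
  normalise (φ ∨ ψ) = normalisable-∨ (normalise φ) (normalise ψ)
  normalise (φ ⊻ ψ) = normalisable-⊻ (normalise φ) (normalise ψ)
  normalise (φ ⇒ ψ) = normalisable-⇒ (normalise φ) (normalise ψ)

-- Renaming of variables

module _ {X Y : Set} (f : X → Y) where

  rename-standard : ∀ {α} → Standard α → Standard (rename f α)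
  rename-standard (var x) = var (f x)
  rename-standard ⊥       = ⊥
  rename-standard (α ∧ β) = rename-standard α ∧ rename-standard β
  rename-standard (α ∨ β) = rename-standard α ∨ rename-standard β
  rename-standard (α ⇒ β) = rename-standard α ⇒ rename-standard β

  ⊢-rename : ∀ {φ} → ⊢ φ → ⊢ rename f φ
  ⊢-rename (mp d e)         = mp (⊢-rename d) (⊢-rename e)
  ⊢-rename (∨-intro _ _)    = ∨-intro _ _
  ⊢-rename (∨-elim _ _ α)   = ∨-elim _ _ (rename-standard α)
  ⊢-rename (∨-mono _ _ _)   = ∨-mono _ _ _
  ⊢-rename (∨-comm _ _)     = ∨-comm _ _
  ⊢-rename (∨-assoc _ _ _)  = ∨-assoc _ _ _
  ⊢-rename (∨-⊻ _ _ _)      = ∨-⊻ _ _ _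
  ⊢-rename (K _ _)          = K _ _
  ⊢-rename (S _ _ _)        = S _ _ _
  ⊢-rename (∧-elimˡ _ _)    = ∧-elimˡ _ _
  ⊢-rename (∧-elimʳ _ _)    = ∧-elimʳ _ _
  ⊢-rename (∧-intro _ _)    = ∧-intro _ _
  ⊢-rename (⊻-introˡ _ _)   = ⊻-introˡ _ _
  ⊢-rename (⊻-introʳ _ _)   = ⊻-introʳ _ _
  ⊢-rename (⊻-elim _ _ _)   = ⊻-elim _ _ _
  ⊢-rename (⊥-elim _)       = ⊥-elim _
  ⊢-rename (split α _ _)    = split (rename-standard α) _ _

-- Soundness

module _ {X : Set} (M : Model X) where
  open Model M
  open IsPartialOrder isPartialOrder renaming (refl to R-refl; trans to R-trans) using ()

  infix 4 _⊩_ _⊵_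

  -- Kripke forcing; the clause for _⊻_ is arbitrary, since only standard formulas matter.
  _⊩_ : W → Formula X → Set
  w ⊩ var x = V x w
  w ⊩ ⊥     = Empty.⊥
  w ⊩ φ ∧ ψ = w ⊩ φ × w ⊩ ψ
  w ⊩ φ ∨ ψ = w ⊩ φ ⊎ w ⊩ ψ
  w ⊩ φ ⊻ ψ = w ⊩ φ ⊎ w ⊩ ψ
  w ⊩ φ ⇒ ψ = ∀ v → R w v → v ⊩ φ → v ⊩ ψ

  -- This is `⊇∘R°` with the intermediate team eliminated: that team can be taken to consist of the
  -- points of `t` that see a point of `s`, which gives the forward half of `R°`.
  _⊵_ : Team M → Team M → Set
  t ⊵ s = ∀ {v} → s v → ∃[ w ] t w × R w v

  ⊇∘R°⇒⊵ : ∀ {t s} → ⊇∘R° M t s → t ⊵ s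
  ⊇∘R°⇒⊵ (r , r⊆t , _ , back) sv = let w , rw , wRv = back _ sv in w , r⊆t rw , wRv

  ⊵⇒⊇∘R° : ∀ {t s} → t ⊵ s → ⊇∘R° M t s
  ⊵⇒⊇∘R° {t} {s} t⊵s =
    (λ w → t w × ∃[ v ] s v × R w v) , proj₁ , (λ _ → proj₂) ,
    λ v sv → let w , tw , wRv = t⊵s sv in w , (tw , v , sv , wRv) , wRv

  ⊆⇒⊵ : ∀ {t s : Team M} → s ⊆ t → t ⊵ s
  ⊆⇒⊵ s⊆t sv = _ , s⊆t sv , R-refl

  ⊵-trans : ∀ {t s r} → t ⊵ s → s ⊵ r → t ⊵ r
  ⊵-trans t⊵s s⊵r rv =
    let u , su , uRv = s⊵r rv ; w , tw , wRu = t⊵s su in w , tw , R-trans wRu uRv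

  ↑_ : Team M → Team M
  (↑ t) v = ∃[ w ] t w × R w v

  sat-⊵ : ∀ φ {t s} → t ⊵ s → Sat M t φ → Sat M s φ
  sat-⊵ (var x) t⊵s (lift t⊆V) =
    lift λ sv → let _ , tw , wRv = t⊵s sv in persistent (t⊆V tw) wRv
  sat-⊵ ⊥       t⊵s (lift empty) = lift λ v sv → let w , tw , _ = t⊵s sv in empty w tw
  sat-⊵ (φ ∧ ψ) t⊵s (p , q) = sat-⊵ φ t⊵s p , sat-⊵ ψ t⊵s q
  sat-⊵ (φ ∨ ψ) t⊵s (t₁ , t₂ , t⊆ , p , q) =
    -- `t₁` and `t₂` cover `t` but need not cover `s`; their upward closures do.
    ↑ t₁ , ↑ t₂ ,
    (λ sv → let w , tw , wRv = t⊵s sv in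
            Sum.map (λ h → w , h , wRv) (λ h → w , h , wRv) (t⊆ tw)) ,
    sat-⊵ φ id p , sat-⊵ ψ id q
  sat-⊵ (φ ⊻ ψ) t⊵s = Sum.map (sat-⊵ φ t⊵s) (sat-⊵ ψ t⊵s)
  sat-⊵ (φ ⇒ ψ) t⊵s p r s⊵r = p r (⊵⇒⊇∘R° (⊵-trans t⊵s (⊇∘R°⇒⊵ s⊵r)))

  sat-⊆ : ∀ φ {t s : Team M} → s ⊆ t → Sat M t φ → Sat M s φ
  sat-⊆ φ s⊆t = sat-⊵ φ (⊆⇒⊵ s⊆t)

  sat-mp : ∀ φ ψ {t} → Sat M t (φ ⇒ ψ) → Sat M t φ → Sat M t ψ
  sat-mp φ ψ p = p _ (⊵⇒⊇∘R° (⊆⇒⊵ id))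

  -- Flatness of standard formulas, by mutual induction because implication is contravariant.
  -- Singleton teams test an implication at a point; conversely, the truth sets of two disjuncts
  -- split a team.
  sat⇒⊩ : ∀ {α} → Standard α → ∀ {t} → Sat M t α → ∀ {w} → t w → w ⊩ α
  ⊩⇒sat : ∀ {α} → Standard α → ∀ {t} → (∀ {w} → t w → w ⊩ α) → Sat M t α
  sat⇒⊩ (var x) (lift t⊆V) tw         = t⊆V tw
  sat⇒⊩ ⊥       (lift empty) tw       = empty _ tw
  sat⇒⊩ (α ∧ β) (p , q) tw            = sat⇒⊩ α p tw , sat⇒⊩ β q tw
  sat⇒⊩ (α ∨ β) (_ , _ , t⊆ , p , q) tw = Sum.map (sat⇒⊩ α p) (sat⇒⊩ β q) (t⊆ tw)
  sat⇒⊩ (α ⇒ β) p {w} tw v wRv v⊩α     =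
    sat⇒⊩ β (p ｛ v ｝ (⊵⇒⊇∘R° λ { refl → w , tw , wRv }) (⊩⇒sat α λ { refl → v⊩α })) refl
  ⊩⇒sat (var x) h = lift h
  ⊩⇒sat ⊥       h = lift λ w tw → h tw
  ⊩⇒sat (α ∧ β) h = ⊩⇒sat α (proj₁ ∘ h) , ⊩⇒sat β (proj₂ ∘ h)
  ⊩⇒sat {α ∨ β} (α-std ∨ β-std) h = (_⊩ α) , (_⊩ β) , h , ⊩⇒sat α-std id , ⊩⇒sat β-std id
  ⊩⇒sat (α ⇒ β) h s t⊵s p =
    ⊩⇒sat β λ sv → let w , tw , wRv = ⊇∘R°⇒⊵ t⊵s sv in h tw _ wRv (sat⇒⊩ α p sv)

  sat-∅ : ∀ φ → Sat M ∅ φ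
  sat-∅ (var x) = lift λ ()
  sat-∅ ⊥       = lift λ _ ()
  sat-∅ (φ ∧ ψ) = sat-∅ φ , sat-∅ ψ
  sat-∅ (φ ∨ ψ) = ∅ , ∅ , (λ ()) , sat-∅ φ , sat-∅ ψ
  sat-∅ (φ ⊻ ψ) = inj₁ (sat-∅ φ)
  sat-∅ (φ ⇒ ψ) s ∅⊵s _ =
    sat-⊆ ψ (λ sv → proj₁ (proj₂ (⊇∘R°⇒⊵ ∅⊵s sv))) (sat-∅ ψ)

  sound : ∀ {φ} → ⊢ φ → ∀ t → Sat M t φ
  sound (mp {φ} {ψ} d e) t = sat-mp φ ψ (sound d t) (sound e t)
  sound (∨-intro φ ψ) t s _ p = s , ∅ , inj₁ , p , sat-∅ ψ
  sound (∨-elim φ ψ α) t t₁ _ p t₂ ⊵₂ q t₃ ⊵₃ (s , r , t₃⊆ , p′ , q′) =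
    -- As `α` is flat, it can be checked pointwise: each point of `t₃` lies in the part of `t₃`
    -- inside `s` or inside `r`, and a premise applies to that part.
    ⊩⇒sat α λ tw → [ (λ sw → sat⇒⊩ α (p (t₃ ∩ s)
                        (⊵⇒⊇∘R° (⊵-trans (⊇∘R°⇒⊵ ⊵₂) (⊇∘R°⇒⊵ ⊵₃) ∘ proj₁))
                        (sat-⊆ φ proj₂ p′)) (tw , sw))
                   , (λ rw → sat⇒⊩ α (q (t₃ ∩ r)
                        (⊵⇒⊇∘R° (⊇∘R°⇒⊵ ⊵₃ ∘ proj₁))
                        (sat-⊆ ψ proj₂ q′)) (tw , rw))
                   ]′ (t₃⊆ tw)
  sound (∨-mono φ ψ χ) t t₁ _ p t₂ ⊵₂ (s , r , t₂⊆ , p′ , q′) =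
    t₂ ∩ s , r , (λ tw → Sum.map₁ (tw ,_) (t₂⊆ tw)) ,
    p (t₂ ∩ s) (⊵⇒⊇∘R° (⊇∘R°⇒⊵ ⊵₂ ∘ proj₁)) (sat-⊆ φ proj₂ p′) , q′
  sound (∨-comm φ ψ) t _ _ (s , r , ⊆∪ , p , q) = r , s , Sum.swap ∘ ⊆∪ , q , p
  sound (∨-assoc φ ψ χ) t _ _ (s , r , ⊆∪ , (s₁ , s₂ , ⊆∪′ , p , q) , p′) =
    s₁ , s₂ ∪ r , Sum.assocʳ ∘ Sum.map₁ ⊆∪′ ∘ ⊆∪ , p , s₂ , r , id , q , p′
  sound (∨-⊻ φ ψ χ) t _ _ (s , r , ⊆∪ , p , q) =
    Sum.map (λ q → s , r , ⊆∪ , p , q) (λ q → s , r , ⊆∪ , p , q) q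
  sound (K φ ψ) t _ _ p s ⊵s _ = sat-⊵ φ (⊇∘R°⇒⊵ ⊵s) p
  sound (S φ ψ χ) t _ _ p s ⊵s q r ⊵r h =
    sat-mp ψ χ (p r (⊵⇒⊇∘R° (⊵-trans (⊇∘R°⇒⊵ ⊵s) (⊇∘R°⇒⊵ ⊵r))) h) (q r ⊵r h)
  sound (∧-elimˡ φ ψ) t _ _ = proj₁
  sound (∧-elimʳ φ ψ) t _ _ = proj₂
  sound (∧-intro φ ψ) t _ _ p s ⊵s q = sat-⊵ φ (⊇∘R°⇒⊵ ⊵s) p , q
  sound (⊻-introˡ φ ψ) t _ _ = inj₁
  sound (⊻-introʳ φ ψ) t _ _ = inj₂
  sound (⊻-elim φ ψ χ) t _ _ p s ⊵s q r ⊵r =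
    [ p r (⊵⇒⊇∘R° (⊵-trans (⊇∘R°⇒⊵ ⊵s) (⊇∘R°⇒⊵ ⊵r))) , q r ⊵r ]′
  sound (⊥-elim φ) t s _ (lift empty) = sat-⊆ φ (λ sw → empty _ sw) (sat-∅ φ)
  -- The α-points above s form the largest team satisfying α to be considered.
  sound (split {α} α-std φ ψ) t s _ p =
    Sum.map (λ q r ⊵r h → sat-⊆ φ (largest r ⊵r h) q)
            (λ q r ⊵r h → sat-⊆ ψ (largest r ⊵r h) q)
            (p (↑ s ∩ (_⊩ α)) (⊵⇒⊇∘R° proj₁) (⊩⇒sat α-std proj₂))
    where
    largest : ∀ r → ⊇∘R° M s r → Sat M r α → r ⊆ ↑ s ∩ (_⊩ α)
    largest r ⊵r h rv = ⊇∘R°⇒⊵ ⊵r rv , sat⇒⊩ α-std h rv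

-- Extending a valuation along an injection

module _ {X Y : Set} (M : Model Y) (f : Y → X) where
  open Model M

  extend : Model X
  extend = record
    { W              = W
    ; point          = point
    ; R              = R
    ; isPartialOrder = isPartialOrder
    ; V              = λ x w → ∃[ y ] f y ≡ x × V y w
    ; persistent     = λ { (y , fy≡x , Vyw) wRv → y , fy≡x , persistent Vyw wRv }
    }

  module _ (f-injective : Injective _≡_ _≡_ f) where

    -- Injectivity enters at variables: in `extend`, the valuation of `f y` collects all variables
    -- with the same image as `y`.
    extend-sat⁻ : ∀ φ {t} → Sat extend t (rename f φ) → Sat M t φ
    extend-sat⁺ : ∀ φ {t} → Sat M t φ → Sat extend t (rename f φ)
    extend-sat⁻ (var y) (lift t⊆V) = lift λ tw →
      let _ , eq , Vw = t⊆V tw in subst (λ y → V y _) (f-injective eq) Vw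
    extend-sat⁻ ⊥       (lift h)   = lift h
    extend-sat⁻ (φ ∧ ψ) (p , q)    = extend-sat⁻ φ p , extend-sat⁻ ψ q
    extend-sat⁻ (φ ∨ ψ) (s , r , ⊆∪ , p , q) = s , r , ⊆∪ , extend-sat⁻ φ p , extend-sat⁻ ψ q
    extend-sat⁻ (φ ⊻ ψ) h          = Sum.map (extend-sat⁻ φ) (extend-sat⁻ ψ) h
    extend-sat⁻ (φ ⇒ ψ) h s ⊵s p   = extend-sat⁻ ψ (h s ⊵s (extend-sat⁺ φ p))
    extend-sat⁺ (var y) (lift t⊆V) = lift λ tw → y , refl , t⊆V tw
    extend-sat⁺ ⊥       (lift h)   = lift h
    extend-sat⁺ (φ ∧ ψ) (p , q)    = extend-sat⁺ φ p , extend-sat⁺ ψ q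
    extend-sat⁺ (φ ∨ ψ) (s , r , ⊆∪ , p , q) = s , r , ⊆∪ , extend-sat⁺ φ p , extend-sat⁺ ψ q
    extend-sat⁺ (φ ⊻ ψ) h          = Sum.map (extend-sat⁺ φ) (extend-sat⁺ ψ) h
    extend-sat⁺ (φ ⇒ ψ) h s ⊵s p   = extend-sat⁺ ψ (h s ⊵s (extend-sat⁻ φ p))

-- Points of the universal model above a given finite set

module _ {n : ℕ} where

  open IsStrictTotalOrder (<ₜ-isStrictTotalOrder {n}) using (_≟_)

  private
    variable
      P       : Pred (Tree n) 0ℓ
      c       : Colour n
      t v w   : Tree n
      A T     : List (Tree n)

  Layered : Pred (Tree n) 0ℓ
  Layered t = ∃[ k ] Layer k t

  ⟶*-cons : Any (_⟶* v) A → node c A ⟶* v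
  ⟶*-cons r = let _ , s , s⟶*v = find r in s ◅ s⟶*v

  ⟶*-uncons : node c A ⟶* v → node c A ≡ v ⊎ Any (_⟶* v) A
  ⟶*-uncons ε       = inj₁ refl
  ⟶*-uncons (s ◅ r) = inj₂ (lose s r)

  _⟶*?_ : ∀ w v → Dec (w ⟶* v)
  any⟶*? : ∀ A v → Dec (Any (_⟶* v) A)
  node c A ⟶*? v =
    map′ [ (λ { refl → ε }) , ⟶*-cons ]′ ⟶*-uncons ((node c A ≟ v) ⊎-dec any⟶*? A v)
  any⟶*? []      v = no λ ()
  any⟶*? (w ∷ A) v = map′ Any.fromSum Any.toSum ((w ⟶*? v) ⊎-dec any⟶*? A v)

  -- A tree already present is discarded, since `branch` accepts a set of successors only as a
  -- strictly increasing list.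
  insert : Tree n → List (Tree n) → List (Tree n)
  insert t []      = t ∷ []
  insert t (a ∷ A) = [ (λ _ → t ∷ a ∷ A) , [ (λ _ → a ∷ A) , (λ _ → a ∷ insert t A) ]′ ]′ (connexₜ t a)

  insert-All : P t → All P A → All P (insert t A)
  insert-All {A = []}            p []       = p ∷ []
  insert-All {t = t} {A = a ∷ A} p (q ∷ qs) with connexₜ t a
  ... | inj₁ _        = p ∷ q ∷ qs
  ... | inj₂ (inj₁ _) = q ∷ qs
  ... | inj₂ (inj₂ _) = q ∷ insert-All p qs

  insert-here : P t → Any P (insert t A)
  insert-here {A = []}            p = here p
  insert-here {t = t} {A = a ∷ A} p with connexₜ t a
  ... | inj₁ _           = here p
  ... | inj₂ (inj₁ refl) = here p
  ... | inj₂ (inj₂ _)    = there (insert-here {A = A} p)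

  insert-there : Any P A → Any P (insert t A)
  insert-there {A = a ∷ A} {t = t} q with connexₜ t a
  ... | inj₁ _        = there q
  ... | inj₂ (inj₁ _) = q
  ... | inj₂ (inj₂ _) with q
  ...   | here p   = here p
  ...   | there qs = there (insert-there qs)

  insert-increasing : Increasing A → Increasing (insert t A)
  insert-increasing {[]}            []       = [] ∷ []
  insert-increasing {a ∷ A} {t = t} (p ∷ ps) with connexₜ t a
  ... | inj₁ t<a         = (t<a ∷ All.map (transₜ t<a) p) ∷ p ∷ ps
  ... | inj₂ (inj₁ refl) = p ∷ ps
  ... | inj₂ (inj₂ a<t)  = insert-All a<t p ∷ insert-increasing ps

  insert-incomparable : All (Incomparable t) A → AllPairs Incomparable A →
                        AllPairs Incomparable (insert t A)
  insert-incomparable {A = []}            _        _        = [] ∷ []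
  insert-incomparable {t} {A = a ∷ A} (q ∷ qs) (p ∷ ps) with connexₜ t a
  ... | inj₁ _        = (q ∷ qs) ∷ p ∷ ps
  ... | inj₂ (inj₁ _) = p ∷ ps
  ... | inj₂ (inj₂ _) = insert-All (swap q) p ∷ insert-incomparable qs ps

  -- The points of `T` minimal for `⟶*`: an antichain with the same up-set as `T`, and the
  -- candidates for the immediate successors of a new root.
  record Minimals (T : List (Tree n)) : Set where
    field
      members      : List (Tree n)
      increasing   : Increasing members
      incomparable : AllPairs Incomparable members
      ⊆-T          : All (_∈ T) members
      below        : All (λ t → Any (_⟶* t) members) T

  -- A new `t` reached from a member is redundant. Otherwise the members that `t` reaches are
  -- dropped and `t` takes over their role.
  minimals : ∀ T → Minimals T
  minimals [] = record
    { members = [] ; increasing = [] ; incomparable = [] ; ⊆-T = [] ; below = [] }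
  minimals (t ∷ T) with minimals T
  ... | record { members = A ; increasing = inc ; incomparable = inco ; ⊆-T = A⊆T ; below = below }
    with any⟶*? A t
  ...   | yes r = record
    { members = A ; increasing = inc ; incomparable = inco
    ; ⊆-T = All.map there A⊆T ; below = r ∷ below }
  ...   | no ¬r = record
    { members      = insert t A′
    ; increasing   = insert-increasing (AllPairs.filter⁺ above? inc)
    ; incomparable = insert-incomparable
                       (All.zip (All.all-filter above? A , All.filter⁺ above? (All.¬Any⇒All¬ A ¬r)))
                       (AllPairs.filter⁺ above? inco)
    ; ⊆-T          = insert-All (here refl) (All.filter⁺ above? (All.map there A⊆T))
    ; below        = insert-here {A = A′} ε ∷ All.map below′ below
    }
    where
    above? : ∀ a → Dec (¬ (t ⟶* a))
    above? a = ¬? (t ⟶*? a)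
    A′ : List (Tree n)
    A′ = filter above? A
    below′ : ∀ {s} → Any (_⟶* s) A → Any (_⟶* s) (insert t A′)
    below′ r with find r
    ... | a , a∈A , a⟶*s with t ⟶*? a
    ...   | yes t⟶*a = insert-here {A = A′} (t⟶*a ◅◅ a⟶*s)
    ...   | no ¬t⟶*a = insert-there (lose (∈-filter⁺ above? a∈A ¬t⟶*a) a⟶*s)

  -- `branch` bounds the layers of the successors by a `k` that one of them attains, so `k` is the
  -- maximum of the given layers.
  topLayer : All Layered (t ∷ A) →
             ∃[ k ] All (λ w → ∃[ j ] j ≤ k × Layer j w) (t ∷ A) × Any (Layer k) (t ∷ A)
  topLayer {A = []}    ((k , l) ∷ [])     = k , (k , ℕ.≤-refl , l) ∷ [] , here l
  topLayer {A = _ ∷ _} ((k , l) ∷ ls) with topLayer ls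
  ... | k′ , ls′ , top with ℕ.≤-total k k′
  ...   | inj₁ k≤k′ = k′ , (k , k≤k′ , l) ∷ ls′ , there top
  ...   | inj₂ k′≤k =
    k , (k , ℕ.≤-refl , l) ∷ All.map (λ (j , j≤k′ , l′) → j , ℕ.≤-trans j≤k′ k′≤k , l′) ls′ , here l

  -- The up-set of `root` is that of `T` with `root` added; `root` may itself belong to `T`.
  record Root (c : Colour n) (T : List (Tree n)) : Set where
    field
      root    : Tree n
      layered : Layered root
      col≡    : col root ≡ c
      above   : All (root ⟶*_) T
      only    : ∀ {v} → root ⟶* v → root ≡ v ⊎ Any (_⟶* v) T

  -- The number of minimal points of `T` decides the kind of node: `first` for none, `single` for
  -- one unless its colour is already `c`, `branch` for two or more.
  makeRoot : All Layered T → All (λ t → c ≤ᶜ col t) T → Root c T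
  makeRoot {T} {c} ls cs = build members increasing incomparable ⊆-T below
    where
    open Minimals (minimals T)

    new : ∀ {A} → All (_∈ T) A → All (λ t → Any (_⟶* t) A) T → Layered (node c A) → Root c T
    new {A} A⊆T below l = record
      { root    = node c A
      ; layered = l
      ; col≡    = refl
      ; above   = All.map ⟶*-cons below
      ; only    = Sum.map₂ (λ r → let _ , a∈A , a⟶*v = find r in lose (All.lookup A⊆T a∈A) a⟶*v)
                  ∘ ⟶*-uncons
      }

    -- When the only minimal point a already has colour c, a itself is the root:
    -- the universal model has no point of that colour immediately below a.
    build : ∀ A → Increasing A → AllPairs Incomparable A → All (_∈ T) A →
            All (λ t → Any (_⟶* t) A) T → Root c T
    build []      _ _ A⊆T below = new A⊆T below (1 , first c)
    build (a ∷ []) _ _ (a∈T ∷ []) below with ≡-dec Bool._≟_ c (col a)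
    ... | yes c≡a = record
      { root    = a
      ; layered = All.lookup ls a∈T
      ; col≡    = sym c≡a
      ; above   = All.map (λ { (here r) → r }) below
      ; only    = inj₂ ∘ lose a∈T
      }
    ... | no c≢a =
      new (a∈T ∷ []) below (_ , single (proj₂ (All.lookup ls a∈T)) (All.lookup cs a∈T , c≢a))
    build A@(_ ∷ _ ∷ _) inc inco A⊆T below =
      let k , ls′ , top = topLayer (All.map (All.lookup ls) A⊆T)
      in new A⊆T below (_ , branch inc (s≤s (s≤s z≤n)) inco ls′ top (All.map (All.lookup cs) A⊆T))

-- Completeness for standard formulas

-- Refuting an assignment to atoms F j means deriving ⋁ (false atoms) from the true ones. The
-- disjunction is encoded by a goal χ that follows from each false atom.
signed : {X : Set} → Formula X → Subset.Side → Formula X → Formula X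
signed χ inside  φ = φ
signed χ outside φ = φ ⇒ χ

module _ {X : Set} where

  literals : ∀ {N} → (Fin N → Formula X) → Formula X → Subset N → Pred (Formula X) 0ℓ
  literals F χ Γ ψ = ∃[ j ] signed χ (Vec.lookup Γ j) (F j) ≡ ψ

  module _ {N} (F : Fin N → Formula X) {χ φ : Formula X} {Γ : Subset N} {j : Fin N}
    (Fj≡φ : F j ≡ φ) where

    literals-∈ : j ∈ₛ Γ → literals F χ Γ φ
    literals-∈ j∈Γ = j , trans (cong (λ s → signed χ s (F j)) ([]=⇒lookup j∈Γ)) Fj≡φ

    literals-∉ : j ∉ₛ Γ → literals F χ Γ (φ ⇒ χ)
    literals-∉ j∉Γ = j ,
      trans (cong (λ s → signed χ s (F j)) (Bool.¬-not (j∉Γ ∘ lookup⇒[]= j Γ))) (cong (_⇒ χ) Fj≡φ)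

  -- The choice of goal replaces excluded middle: the case of a true atom proves that the atom
  -- implies `χ`, and this is just the extra hypothesis of the case where the atom is false.
  exhaust : ∀ {N} (F : Fin N → Formula X) {H χ} →
            (∀ Γ → H ∪ literals F χ Γ ⊢ʰ χ) → H ⊢ʰ χ
  exhaust {zero}  F {H} {χ} d = weaken [ id , (λ ()) ]′ (d [])
  exhaust {suc N} F {H} {χ} d = exhaust (F ∘ suc) λ Γ →
    app (deduction (weaken (shift outside Γ) (d (outside ∷ Γ))))
        (deduction (weaken (shift inside Γ) (d (inside ∷ Γ))))
    where
    shift : ∀ s Γ → H ∪ literals F χ (s ∷ Γ) ⊆ (H ∪ literals (F ∘ suc) χ Γ) ▸ signed χ s (F zero)
    shift s Γ (inj₁ h)            = inj₁ (inj₁ h)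
    shift s Γ (inj₂ (zero , eq))  = inj₂ eq
    shift s Γ (inj₂ (suc j , eq)) = inj₁ (inj₂ (j , eq))

-- Finite search

search : ∀ {N} {P Q : Pred (Subset N) 0ℓ} → (∀ Γ → P Γ ⊎ Q Γ) → (∀ Γ → P Γ) ⊎ ∃ Q
search {zero}  f = Sum.map (λ { p [] → p }) ([] ,_) (f [])
search {suc N} f with search (f ∘ (inside ∷_)) | search (f ∘ (outside ∷_))
... | inj₂ (Γ , q) | _            = inj₂ (inside ∷ Γ , q)
... | inj₁ _       | inj₂ (Γ , q) = inj₂ (outside ∷ Γ , q)
... | inj₁ p       | inj₁ p′      = inj₁ λ { (true ∷ Γ) → p Γ ; (false ∷ Γ) → p′ Γ }

sequence : ∀ {m} {A : Set} {P : Pred (Fin m) 0ℓ} → (∀ k → A ⊎ P k) → A ⊎ (∀ k → P k)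
sequence {zero}  f = inj₂ λ ()
sequence {suc m} f with f zero | sequence (f ∘ suc)
... | inj₁ a | _      = inj₁ a
... | inj₂ _ | inj₁ a = inj₁ a
... | inj₂ p | inj₂ h = inj₂ λ { zero → p ; (suc k) → h k }

-- The list keeps the very witness chosen for each `k`, so that a point built from the list is known
-- to lie below that witness.
collect : ∀ {m} {P Q : Pred (Fin m) 0ℓ} → (∀ k → P k ⊎ Q k) →
          Σ[ E ∈ List (∃ Q) ] (∀ k → P k ⊎ Σ[ q ∈ Q k ] (k , q) ∈ E)
collect {zero}  f = [] , λ ()
collect {suc m} f with f zero | collect (f ∘ suc)
... | inj₁ p | E , h = map (λ (k , q) → suc k , q) E , λ
  { zero    → inj₁ p
  ; (suc k) → Sum.map₂ (λ (q , e∈E) → q , ∈-map⁺ _ e∈E) (h k) }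
... | inj₂ q | E , h = (zero , q) ∷ map (λ (k , q) → suc k , q) E , λ
  { zero    → inj₂ (q , here refl)
  ; (suc k) → Sum.map₂ (λ (q , e∈E) → q , there (∈-map⁺ _ e∈E)) (h k) }

⊆⊎∃ : ∀ {N} (Γ Δ : Subset N) → Γ ⊆ₛ Δ ⊎ ∃[ x ] x ∈ₛ Γ × x ∉ₛ Δ
⊆⊎∃ Γ Δ with any? (λ x → (x ∈ₛ? Γ) ×-dec ¬? (x ∈ₛ? Δ))
... | yes e = inj₂ e
... | no ¬e = inj₁ λ {x} x∈Γ → decidable-stable (x ∈ₛ? Δ) λ x∉Δ → ¬e (x , x∈Γ , x∉Δ)

-- Listed implications count as atoms, so an assignment determines the truth of a formula without
-- looking inside them.
data Over {n m} (lhs rhs : Fin m → Formula (Fin n)) : Formula (Fin n) → Set where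
  var : ∀ i → Over lhs rhs (var i)
  ⊥   : Over lhs rhs ⊥
  _∧_ : ∀ {φ ψ} → Over lhs rhs φ → Over lhs rhs ψ → Over lhs rhs (φ ∧ ψ)
  _∨_ : ∀ {φ ψ} → Over lhs rhs φ → Over lhs rhs ψ → Over lhs rhs (φ ∨ ψ)
  imp : ∀ k → Over lhs rhs (lhs k ⇒ rhs k)

-- Truth assignments and the points realising them

module StandardCompleteness {n m} (lhs rhs : Fin m → Formula (Fin n))
  (over-lhs : ∀ k → Over lhs rhs (lhs k)) (over-rhs : ∀ k → Over lhs rhs (rhs k)) where

  private
    N : ℕ
    N = n + m

    variable
      φ χ : Formula (Fin n)
      Γ Δ : Subset N

  atom : Fin N → Formula (Fin n)
  atom = [ var , (λ k → lhs k ⇒ rhs k) ]′ ∘ splitAt n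

  ⟨_⟩ : Fin m → Fin N
  ⟨ k ⟩ = n ↑ʳ k

  atom-var : ∀ i → atom (i ↑ˡ m) ≡ var i
  atom-var i rewrite splitAt-↑ˡ n i m = refl

  atom-imp : ∀ k → atom ⟨ k ⟩ ≡ (lhs k ⇒ rhs k)
  atom-imp k rewrite splitAt-↑ʳ n m k = refl

  -- Matching on imp k replaces φ and ψ by lhs k and rhs k, which hides the structural descent;
  -- hence the case of an implication takes its induction hypotheses as arguments.
  over-⇒-standard : ∀ {φ ψ} → Over lhs rhs (φ ⇒ ψ) → (Over lhs rhs φ → Standard φ) →
                    (Over lhs rhs ψ → Standard ψ) → Standard (φ ⇒ ψ)
  over-⇒-standard (imp k) f g = f (over-lhs k) ⇒ g (over-rhs k)

  over-standard : ∀ φ → Over lhs rhs φ → Standard φ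
  over-standard (var _) (var i) = var i
  over-standard ⊥       ⊥       = ⊥
  over-standard (φ ∧ ψ) (d ∧ e) = over-standard φ d ∧ over-standard ψ e
  over-standard (φ ∨ ψ) (d ∨ e) = over-standard φ d ∨ over-standard ψ e
  over-standard (φ ⇒ ψ) d       = over-⇒-standard d (over-standard φ) (over-standard ψ)

  Holds : Subset N → Over lhs rhs φ → Set
  Holds Γ (var i) = i ↑ˡ m ∈ₛ Γ
  Holds Γ ⊥       = Empty.⊥
  Holds Γ (d ∧ e) = Holds Γ d × Holds Γ e
  Holds Γ (d ∨ e) = Holds Γ d ⊎ Holds Γ e
  Holds Γ (imp k) = ⟨ k ⟩ ∈ₛ Γ

  holds? : ∀ Γ (d : Over lhs rhs φ) → Dec (Holds Γ d)
  holds? Γ (var i) = i ↑ˡ m ∈ₛ? Γ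
  holds? Γ ⊥       = no id
  holds? Γ (d ∧ e) = holds? Γ d ×-dec holds? Γ e
  holds? Γ (d ∨ e) = holds? Γ d ⊎-dec holds? Γ e
  holds? Γ (imp k) = ⟨ k ⟩ ∈ₛ? Γ

  Literals : Formula (Fin n) → Subset N → Pred (Formula (Fin n)) 0ℓ
  Literals = literals atom

  ⊢-holds : (d : Over lhs rhs φ) → Holds Γ d → Literals χ Γ ⊢ʰ φ
  ⊢-holds (var i) h        = hyp (literals-∈ atom (atom-var i) h)
  ⊢-holds (d ∧ e) (h , h′) = pairʰ (⊢-holds d h) (⊢-holds e h′)
  ⊢-holds (d ∨ e) (inj₁ h) = app (thm (∨-intro _ _)) (⊢-holds d h)
  ⊢-holds (d ∨ e) (inj₂ h) = app (thm (∨-introʳ _ _)) (⊢-holds e h)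
  ⊢-holds (imp k) h        = hyp (literals-∈ atom (atom-imp k) h)

  -- `χ` is standard for the sake of the disjunction case, which rests on `∨-elim`.
  ⊢-¬holds : Standard χ → (d : Over lhs rhs φ) → ¬ Holds Γ d → Literals χ Γ ⊢ʰ φ ⇒ χ
  ⊢-¬holds χ-std (var i) ¬h = hyp (literals-∉ atom (atom-var i) ¬h)
  ⊢-¬holds χ-std ⊥ ¬h = thm (⊥-elim _)
  ⊢-¬holds {Γ = Γ} χ-std (d ∧ e) ¬h with holds? Γ d
  ... | no ¬d = deduction (app (weaken inj₁ (⊢-¬holds χ-std d ¬d)) (fstʰ last))
  ... | yes h = deduction (app (weaken inj₁ (⊢-¬holds χ-std e (¬h ∘ (h ,_)))) (sndʰ last))
  ⊢-¬holds χ-std (d ∨ e) ¬h =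
    app (app (thm (∨-elim _ _ χ-std)) (⊢-¬holds χ-std d (¬h ∘ inj₁)))
        (⊢-¬holds χ-std e (¬h ∘ inj₂))
  ⊢-¬holds χ-std (imp k) ¬h = hyp (literals-∉ atom (atom-imp k) ¬h)

  -- All standard goals are allowed, since `refuted-imp` applies refutations of larger assignments
  -- to the goal `rhs k`.
  Refuted : Pred (Subset N) 0ℓ
  Refuted Γ = ∀ χ → Standard χ → Literals χ Γ ⊢ʰ χ

  colourOf : Subset N → Colour n
  colourOf Γ = Vec.tabulate λ i → Vec.lookup Γ (i ↑ˡ m)

  colour-mono : Γ ⊆ₛ Δ → colourOf Γ ≤ᶜ colourOf Δ
  colour-mono {Γ} {Δ} Γ⊆Δ = Pointwise.tabulate⁺ λ i → lookup-mono (i ↑ˡ m)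
    where
    lookup-mono : ∀ j → Vec.lookup Γ j Bool.≤ Vec.lookup Δ j
    lookup-mono j with Vec.lookup Γ j in eq
    ... | false = Bool.≤-minimum _
    ... | true  = Bool.≤-reflexive (sym ([]=⇒lookup (Γ⊆Δ (lookup⇒[]= j Γ eq))))

  infix 4 _⊩ᵘ_

  _⊩ᵘ_ : Node n → Formula (Fin n) → Set
  _⊩ᵘ_ = _⊩_ (𝒰 n)

  -- Quantifying over `d` makes agreement vacuous for formulas outside `Over`, so it can be stated
  -- for all formulas and proved by recursion on them.
  Agree : (t : Tree n) → Layered t → Subset N → Formula (Fin n) → Set
  Agree t l Γ φ = (d : Over lhs rhs φ) →
    (mkNode t l ⊩ᵘ φ → Holds Γ d) × (Holds Γ d → mkNode t l ⊩ᵘ φ)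

  record Realised (Γ : Subset N) : Set where
    field
      tree    : Tree n
      layered : Layered tree
      col≡    : col tree ≡ colourOf Γ
      agree   : ∀ φ → Agree tree layered Γ φ

  open Realised

  module _ (Γ : Subset N) where

    -- In these cases `Γ` itself accounts for the status of implication `k`. In `Above`, the failure
    -- of the implication is witnessed by a larger realised assignment.
    Locally : Pred (Fin m) 0ℓ
    Locally k = (⟨ k ⟩ ∈ₛ Γ × (Holds Γ (over-lhs k) → Holds Γ (over-rhs k)))
              ⊎ (⟨ k ⟩ ∉ₛ Γ × Holds Γ (over-lhs k) × ¬ Holds Γ (over-rhs k))

    Above : Pred (Fin m) 0ℓ
    Above k = ⟨ k ⟩ ∉ₛ Γ ×
      ∃[ Δ ] Γ ⊂ Δ × Holds Δ (over-lhs k) × ¬ Holds Δ (over-rhs k) × Realised Δ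

    -- Under the extra hypothesis `lhs k` and with goal `rhs k`, every `Δ` is dealt with: it
    -- falsifies `lhs k`, verifies `rhs k`, falsifies an atom true in `Γ`, or properly extends `Γ`
    -- and is refuted; `Γ` itself falsifies `lhs k`. So the literals of `Γ` prove implication `k`,
    -- an atom false in `Γ`.
    refuted-imp : ∀ k → ⟨ k ⟩ ∉ₛ Γ → ¬ Holds Γ (over-lhs k) →
                  (∀ Δ → Γ ⊂ Δ → Holds Δ (over-lhs k) → ¬ Holds Δ (over-rhs k) → Refuted Δ) →
                  Refuted Γ
    refuted-imp k k∉Γ ¬a refuted χ χ-std =
      app (hyp (literals-∉ atom (atom-imp k) k∉Γ))
          (deduction (exhaust atom derive))
      where
      b-std : Standard (rhs k)
      b-std = over-standard _ (over-rhs k)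
      derive : ∀ Δ → (Literals χ Γ ▸ lhs k) ∪ Literals (rhs k) Δ ⊢ʰ rhs k
      derive Δ with holds? Δ (over-lhs k) | holds? Δ (over-rhs k)
      ... | no ¬a′ | _      =
        app (weaken inj₂ (⊢-¬holds b-std (over-lhs k) ¬a′)) (hyp (inj₁ (inj₂ refl)))
      ... | _      | yes b′ = weaken inj₂ (⊢-holds (over-rhs k) b′)
      ... | yes a′ | no ¬b′ with ⊆⊎∃ Γ Δ | ⊆⊎∃ Δ Γ
      ...   | inj₂ (x , x∈Γ , x∉Δ) | _         =
        app (hyp (inj₂ (literals-∉ atom refl x∉Δ))) (hyp (inj₁ (inj₁ (literals-∈ atom refl x∈Γ))))
      ...   | inj₁ Γ⊆Δ             | inj₂ e    = weaken inj₂ (refuted Δ (Γ⊆Δ , e) a′ ¬b′ (rhs k) b-std)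
      ...   | inj₁ Γ⊆Δ             | inj₁ Δ⊆Γ with ⊆-antisym Γ⊆Δ Δ⊆Γ
      ...     | refl = contradiction a′ ¬a

    check : (∀ {Δ} → Γ ⊂ Δ → Refuted Δ ⊎ Realised Δ) → ∀ k → Refuted Γ ⊎ (Locally k ⊎ Above k)
    check ih k with ⟨ k ⟩ ∈ₛ? Γ | holds? Γ (over-lhs k) | holds? Γ (over-rhs k)
    ... | yes k∈Γ | _     | yes b = inj₂ (inj₁ (inj₁ (k∈Γ , λ _ → b)))
    ... | yes k∈Γ | no ¬a | _     = inj₂ (inj₁ (inj₁ (k∈Γ , λ a → contradiction a ¬a)))
    -- Modus Ponens derives the consequent, which `Γ` makes false.
    ... | yes k∈Γ | yes a | no ¬b = inj₁ λ χ χ-std →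
      app (⊢-¬holds χ-std (over-rhs k) ¬b) (app (⊢-holds (imp k) k∈Γ) (⊢-holds (over-lhs k) a))
    -- By `K`, the true consequent proves the implication that `Γ` makes false.
    ... | no k∉Γ  | _     | yes b = inj₁ λ χ χ-std →
      app (⊢-¬holds χ-std (imp k) k∉Γ) (app (thm (K _ _)) (⊢-holds (over-rhs k) b))
    ... | no k∉Γ  | yes a | no ¬b = inj₂ (inj₁ (inj₂ (k∉Γ , a , ¬b)))
    -- The failure must occur higher up: either some larger assignment witnessing it is realised, or
    -- all candidates are refuted and hence so is `Γ`.
    ... | no k∉Γ  | no ¬a | no _  =
      Sum.map (refuted-imp k k∉Γ ¬a) (λ w → inj₂ (k∉Γ , w)) (search decide)
      where
      decide : ∀ Δ → (Γ ⊂ Δ → Holds Δ (over-lhs k) → ¬ Holds Δ (over-rhs k) → Refuted Δ) ⊎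
                     (Γ ⊂ Δ × Holds Δ (over-lhs k) × ¬ Holds Δ (over-rhs k) × Realised Δ)
      decide Δ with Γ ⊂? Δ | holds? Δ (over-lhs k) | holds? Δ (over-rhs k)
      ... | no Γ⊄Δ  | _     | _     = inj₁ λ Γ⊂Δ → contradiction Γ⊂Δ Γ⊄Δ
      ... | _       | no ¬a | _     = inj₁ λ _ a → contradiction a ¬a
      ... | _       | _     | yes b = inj₁ λ _ _ ¬b → contradiction b ¬b
      ... | yes Γ⊂Δ | yes a | no ¬b =
        Sum.map (λ r _ _ _ → r) (λ r → Γ⊂Δ , a , ¬b , r) (ih Γ⊂Δ)

    -- A point above the new root is the root or lies above a realised witness, whose assignment
    -- includes `Γ`. So implications true in `Γ` hold throughout, and those false in `Γ` fail at the
    -- root or at their witness.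
    realise : (∀ k → Locally k ⊎ Above k) → Realised Γ
    realise f = record
      { tree = root ; layered = root-layered ; col≡ = root-col≡ ; agree = agree′ }
      where
      E : List (∃ Above)
      E = proj₁ (collect f)

      treeᴱ : ∃ Above → Tree n
      treeᴱ (_ , _ , _ , _ , _ , _ , r) = tree r

      R : Root (colourOf Γ) (map treeᴱ E)
      R = makeRoot
        (All.map⁺ (All.universal (λ (_ , _ , _ , _ , _ , _ , r) → layered r) E))
        (All.map⁺ (All.universal
          (λ (_ , _ , _ , (Γ⊆Δ , _) , _ , _ , r) →
            subst (colourOf Γ ≤ᶜ_) (sym (col≡ r)) (colour-mono Γ⊆Δ)) E))

      open Root R using (root; above; only) renaming (layered to root-layered; col≡ to root-col≡)

      w : Node n
      w = mkNode root root-layered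

      colour-lookup : ∀ i → Vec.lookup (col root) i ≡ Vec.lookup Γ (i ↑ˡ m)
      colour-lookup i = trans (cong (λ c → Vec.lookup c i) root-col≡) (lookup∘tabulate _ i)

      Agreeʷ : Formula (Fin n) → Set
      Agreeʷ = Agree root root-layered Γ

      agree-⇒ : ∀ {φ ψ} → Agreeʷ φ → Agreeʷ ψ → Agreeʷ (φ ⇒ ψ)
      agree-⇒ {φ} {ψ} agreeφ agreeψ (imp k) = to , from
        where
        to : w ⊩ᵘ φ ⇒ ψ → ⟨ k ⟩ ∈ₛ Γ
        to h with proj₂ (collect f) k
        ... | inj₁ (inj₁ (k∈Γ , _))    = k∈Γ
        ... | inj₁ (inj₂ (_ , a , ¬b)) =
          contradiction (proj₁ (agreeψ (over-rhs k)) (h w ε (proj₂ (agreeφ (over-lhs k)) a))) ¬b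
        ... | inj₂ ((_ , Δ , _ , a , ¬b , r) , e∈E) =
          contradiction
            (proj₁ (agree r ψ (over-rhs k))
              (h (mkNode (tree r) (layered r)) (All.lookup (All.map⁻ above) e∈E)
                 (proj₂ (agree r φ (over-lhs k)) a)))
            ¬b

        from : ⟨ k ⟩ ∈ₛ Γ → w ⊩ᵘ φ ⇒ ψ
        from k∈Γ v w⟶*v v⊩φ with only w⟶*v
        ... | inj₁ refl with proj₂ (collect f) k
        ...   | inj₁ (inj₁ (_ , a⇒b)) =
          proj₂ (agreeψ (over-rhs k)) (a⇒b (proj₁ (agreeφ (over-lhs k)) v⊩φ))
        ...   | inj₁ (inj₂ (k∉Γ , _)) = contradiction k∈Γ k∉Γ
        ...   | inj₂ ((k∉Γ , _) , _)  = contradiction k∈Γ k∉Γ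
        from k∈Γ v w⟶*v v⊩φ | inj₂ reach with Any.satisfied (Any.map⁻ reach)
        ... | (_ , _ , _ , (Γ⊆Δ , _) , _ , _ , r) , r⟶*v =
          proj₂ (agree r (φ ⇒ ψ) (imp k)) (Γ⊆Δ k∈Γ) v r⟶*v v⊩φ

      agree′ : ∀ φ → Agreeʷ φ
      agree′ (var _) (var i) =
        (λ h → lookup⇒[]= _ Γ (trans (sym (colour-lookup i)) h)) ,
        (λ h → trans (colour-lookup i) ([]=⇒lookup h))
      agree′ ⊥       ⊥       = id , id
      agree′ (φ ∧ ψ) (d ∧ e) =
        let f , g = agree′ φ d ; f′ , g′ = agree′ ψ e
        in (λ (h , h′) → f h , f′ h′) , (λ (h , h′) → g h , g′ h′)
      agree′ (φ ∨ ψ) (d ∨ e) =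
        let f , g = agree′ φ d ; f′ , g′ = agree′ ψ e
        in Sum.map f f′ , Sum.map g g′
      agree′ (φ ⇒ ψ) d       = agree-⇒ (agree′ φ) (agree′ ψ) d

  refuted-or-realised : ∀ Γ → Refuted Γ ⊎ Realised Γ
  refuted-or-realised Γ = go Γ (⊃-wellFounded Γ)
    where
    go : ∀ Γ → Acc Subset._⊃_ Γ → Refuted Γ ⊎ Realised Γ
    go Γ (acc rec) = Sum.map₂ (realise Γ) (sequence (check Γ λ {Δ} Γ⊂Δ → go Δ (rec Γ⊂Δ)))

  -- The goal of the exhaustion is `φ` itself: an assignment making `φ` true derives it, and one
  -- making `φ` false cannot be realised, hence is refuted.
  completeness : Over lhs rhs φ → (∀ w → w ⊩ᵘ φ) → ⊢ φ
  completeness {φ} d valid = discharge (exhaust atom λ Γ → weaken inj₂ (derive Γ))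
    where
    derive : ∀ Γ → Literals φ Γ ⊢ʰ φ
    derive Γ with holds? Γ d | refuted-or-realised Γ
    ... | yes h | _      = ⊢-holds d h
    ... | no _  | inj₁ r = r φ (over-standard φ d)
    ... | no ¬h | inj₂ r = contradiction (proj₁ (agree r φ d) (valid _)) ¬h

-- Subformula closure and passage to arbitrary formulas

module _ {n : ℕ} where

  private
    variable
      φ : Formula (Fin n)

  implications : Formula (Fin n) → List (Formula (Fin n) × Formula (Fin n))
  implications (var _) = []
  implications ⊥       = []
  implications (φ ∧ ψ) = implications φ ++ implications ψ
  implications (φ ∨ ψ) = implications φ ++ implications ψ
  implications (φ ⊻ ψ) = implications φ ++ implications ψ
  implications (φ ⇒ ψ) = (φ , ψ) ∷ implications φ ++ implications ψ

  module _ (L : List (Formula (Fin n) × Formula (Fin n))) where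

    lhs rhs : Fin (length L) → Formula (Fin n)
    lhs k = proj₁ (lookup L k)
    rhs k = proj₂ (lookup L k)

    -- `L` stays fixed while `φ` descends to subformulas, so only inclusion in `L` is maintained.
    Implications⊆ : Pred (Formula (Fin n)) 0ℓ
    Implications⊆ φ = ∀ {e} → e ∈ implications φ → e ∈ L

    over : Standard φ → Implications⊆ φ → Over lhs rhs φ
    over (var i) sub = var i
    over ⊥       sub = ⊥
    over (α ∧ β) sub = over α (sub ∘ ∈-++⁺ˡ) ∧ over β (sub ∘ ∈-++⁺ʳ _)
    over (α ∨ β) sub = over α (sub ∘ ∈-++⁺ˡ) ∨ over β (sub ∘ ∈-++⁺ʳ _)
    over (α ⇒ β) sub =
      subst (λ (φ , ψ) → Over lhs rhs (φ ⇒ ψ)) (sym (Any.lookup-index (sub (here refl))))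
        (imp (Any.index (sub (here refl))))

    -- When `L` consists of the implications of `φ` itself, this supplies the two closure hypotheses
    -- of `StandardCompleteness`.
    over-implications : Standard φ → Implications⊆ φ →
      All (λ (φ , ψ) → Over lhs rhs φ × Over lhs rhs ψ) (implications φ)
    over-implications (var i) sub = []
    over-implications ⊥       sub = []
    over-implications (α ∧ β) sub =
      All.++⁺ (over-implications α (sub ∘ ∈-++⁺ˡ)) (over-implications β (sub ∘ ∈-++⁺ʳ _))
    over-implications (α ∨ β) sub =
      All.++⁺ (over-implications α (sub ∘ ∈-++⁺ˡ)) (over-implications β (sub ∘ ∈-++⁺ʳ _))
    over-implications (α ⇒ β) sub =
      (over α (sub ∘ there ∘ ∈-++⁺ˡ) , over β (sub ∘ there ∘ ∈-++⁺ʳ _)) ∷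
      All.++⁺ (over-implications α (sub ∘ there ∘ ∈-++⁺ˡ))
              (over-implications β (sub ∘ there ∘ ∈-++⁺ʳ _))

  standard-completeness : Standard φ → (∀ w → _⊩_ (𝒰 n) w φ) → ⊢ φ
  standard-completeness {φ} α =
    completeness (over L α id)
    where
    L = implications φ
    closed : ∀ k → Over (lhs L) (rhs L) (lhs L k) × Over (lhs L) (rhs L) (rhs L k)
    closed k = All.lookup (over-implications L α id) (∈-lookup k)
    open StandardCompleteness (lhs L) (rhs L) (proj₁ ∘ closed) (proj₂ ∘ closed)

  normal-completeness : Normal φ → Sat (𝒰 n) U φ → ⊢ φ
  normal-completeness (leaf α) h = standard-completeness α λ w → sat⇒⊩ (𝒰 n) α h _
  normal-completeness (N ⊻ N′) (inj₁ h) = mp (⊻-introˡ _ _) (normal-completeness N h)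
  normal-completeness (N ⊻ N′) (inj₂ h) = mp (⊻-introʳ _ _) (normal-completeness N′ h)

proposition3p13 : (P : Set) (n : ℕ) (p : Fin n → P) → Injective _≡_ _≡_ p →
    (φ : Formula (Fin n)) → (𝒰 n ⊨ₜ φ) ⇔ (⊢ rename p φ)
proposition3p13 P n p p-injective φ = mk⇔ complete sound′
  where
  complete : 𝒰 n ⊨ₜ φ → ⊢ rename p φ
  complete valid with normalise φ
  ... | ψ , N , ψ⇒φ , φ⇒ψ =
    ⊢-rename p (mp ψ⇒φ (normal-completeness N (sat-mp (𝒰 n) φ ψ (sound (𝒰 n) φ⇒ψ U) (valid U))))

  sound′ : ⊢ rename p φ → 𝒰 n ⊨ₜ φ
  -- The derivation may use variables outside the image of `p`, so it is interpreted in the extended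
  -- model.
  sound′ d t = extend-sat⁻ (𝒰 n) p p-injective φ (sound (extend (𝒰 n) p) d t)
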